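{- For every $N\in\{3,4,\dots\}$ and all marksmanships $p_1,\dots,p_N\in(0,1)$, the $N$-uel has a stationary deterministic Nash equilibrium.
   Context: The $N$-uel is a turn-based perfect-information game with players $P_1,\dots,P_N$. A state is $\mathbf{s}=s_0s_1\dots s_N$, where for $j\ge1$, $s_j=1$ (resp. $0$) means $P_j$ is alive (resp. dead), and $s_0$ is the index of the player who has the move ($s_0=0$ if the game is over). The set of admissible states is $S=\bigcup_{k=1}^N S_k$, where $S_1$ is the set of terminal states $0s_1\dots s_N$ with exactly one $s_j=1$ ($j\ge1$), and, for $k\in\{2,\dots,N\}$, $S_k=\{s_0s_1\dots s_N: s_0\neq0,\ s_{s_0}=1,\ \sum_{j=1}^N s_j=k\}$. At each nonterminal state the player $P_m$ having the move must shoot at exactly one alive player other than himself, and kills his target with probability $p_m$ (his marksmanship; otherwise the target survives); the move then passes to the next surviving player in the cyclic order $1\to2\to\dots\to N\to1$. The game ends when a single player is alive (then $s_0=0$); this player receives payoff $1$ and the others payoff $0$ (everyone receives $0$ on a play that never terminates). A nonterminal history is a sequence $\mathbf{s}(0)a(1)\mathbf{s}(1)\dots a(t)\mathbf{s}(t)$ of states and targets that can occur in the game with $\mathbf{s}(t)\notin S_1$. An (admissible) strategy $\sigma_n$ of $P_n$ assigns to each nonterminal history a vector $(x_{n1},\dots,x_{nN})$: it is $(0,\dots,0)$ if $P_n$ does not have the move at the current state, and otherwise it is a probability vector, $x_{nm}$ being the probability that $P_n$ shoots $P_m$, supported on the alive players other than $P_n$. A strategy is stationary if it depends only on the current state, and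 deterministic (pure) if the probability vectors put mass one on a single target. A strategy profile is a vector $\sigma=(\sigma_1,\dots,\sigma_N)$; it is stationary (deterministic) if all its components are. $Q_n(\mathbf{s},\sigma)$ is the expected payoff of $P_n$ (his winning probability) when the game starts at state $\mathbf{s}$ and the profile $\sigma$ is used. A profile $\widehat{\sigma}$ is a Nash equilibrium if for every initial admissible state $\mathbf{s}$, every player $P_n$ and every admissible strategy $\sigma_n$ of $P_n$, $Q_n(\mathbf{s},\widehat{\sigma})\ge Q_n(\mathbf{s},\widehat{\sigma}')$, where $\widehat{\sigma}'$ is $\widehat{\sigma}$ with $\widehat{\sigma}_n$ replaced by $\sigma_n$. -}

module Defs where

open import Algebra.Bundles using (CommutativeRing)
import Algebra.Properties.Ring as RingProperties
import Algebra.Properties.Semiring.Sum as SemiringSum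
open import Data.Bool.Base using (true; false; if_then_else_)
open import Data.Fin.Base using (Fin; zero; suc; toℕ)
open import Data.Fin.Properties using (nonZeroIndex; _≟_)
open import Data.Fin.Subset using (Subset; _∈_; ∣_∣) renaming (_-_ to _∖_)
open import Data.Fin.Subset.Properties using (_∈?_)
open import Data.Nat.Base as ℕ using (ℕ; zero; suc; _≡ᵇ_)
open import Data.Nat.DivMod using (_mod_)
open import Data.Product.Base using (_×_; _,_; proj₁; proj₂; ∃; ∃-syntax)
open import Data.Vec.Base using (lookup)
open import Data.Vec.Functional using (Vector)
open import Level using (0ℓ)
open import Relation.Binary.Core using (Rel)
open import Relation.Binary.PropositionalEquality.Core as ≡ using (_≡_; _≢_)
open import Relation.Binary.Structures using (IsTotalOrder)
import Relation.Binary.Construct.NonStrictToStrict as ToStrict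
open import Relation.Nullary using (¬_; Dec; yes; no)
open import Relation.Nullary.Decidable using (¬?; _×-dec_)
open import Relation.Unary using (Pred)

-- The real numbers, given by their classical characterisation (unique up to
-- isomorphism) as a totally ordered field in which every inhabited set that
-- is bounded above has a least upper bound.
record RealNumbers : Set₁ where
  infix 4 _≤_
  field
    commutativeRing : CommutativeRing 0ℓ 0ℓ

  open CommutativeRing commutativeRing public hiding (zero)

  field
    0≉1          : 0# ≉ 1#
    invertible   : ∀ {x} → x ≉ 0# → ∃[ y ] x * y ≈ 1#
    _≤_          : Rel Carrier 0ℓ
    isTotalOrder : IsTotalOrder _≈_ _≤_
    +-monoʳ-≤    : ∀ z {x y} → x ≤ y → z + x ≤ z + y
    *-nonNeg     : ∀ {x y} → 0# ≤ x → 0# ≤ y → 0# ≤ x * y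

  UpperBound : Pred Carrier 0ℓ → Pred Carrier 0ℓ
  UpperBound A b = ∀ {x} → A x → x ≤ b

  LeastUpperBound : Pred Carrier 0ℓ → Pred Carrier 0ℓ
  LeastUpperBound A s = UpperBound A s × (∀ {b} → UpperBound A b → s ≤ b)

  field
    complete : ∀ (A : Pred Carrier 0ℓ) → ∃ A → ∃ (UpperBound A) →
               ∃ (LeastUpperBound A)

  open IsTotalOrder isTotalOrder public
    using (total; antisym; ≤-respˡ-≈; ≤-respʳ-≈)
    renaming (refl to ≤-refl; trans to ≤-trans; reflexive to ≤-reflexive)

  open ToStrict _≈_ _≤_ public using (_<_)

  open SemiringSum semiring public using (sum)

module OrderLemmas (ℝ : RealNumbers) where
  open RealNumbers ℝ
  open RingProperties ring using (-‿distribʳ-*)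

  +-mono-≤ : ∀ {w x y z} → w ≤ x → y ≤ z → w + y ≤ x + z
  +-mono-≤ {w} {x} {y} {z} w≤x y≤z =
    ≤-trans (+-monoʳ-≤ w y≤z)
      (≤-respˡ-≈ (+-comm z w) (≤-respʳ-≈ (+-comm z x) (+-monoʳ-≤ z w≤x)))

  x≤y⇒0≤y-x : ∀ {x y} → x ≤ y → 0# ≤ y - x
  x≤y⇒0≤y-x {x} {y} x≤y =
    ≤-respˡ-≈ (-‿inverseˡ x) (≤-respʳ-≈ (+-comm (- x) y) (+-monoʳ-≤ (- x) x≤y))

  y+[x-y]≈x : ∀ x y → y + (x - y) ≈ x
  y+[x-y]≈x x y = trans (+-congˡ (+-comm x (- y)))
    (trans (sym (+-assoc y (- y) x))
      (trans (+-congʳ (-‿inverseʳ y)) (+-identityˡ x)))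

  0≤y-x⇒x≤y : ∀ {x y} → 0# ≤ y - x → x ≤ y
  0≤y-x⇒x≤y {x} {y} 0≤d =
    ≤-respˡ-≈ (+-identityʳ x) (≤-respʳ-≈ (y+[x-y]≈x y x) (+-monoʳ-≤ x 0≤d))

  *-monoʳ-≤ : ∀ {x y z} → 0# ≤ x → y ≤ z → x * y ≤ x * z
  *-monoʳ-≤ {x} {y} {z} 0≤x y≤z = 0≤y-x⇒x≤y
    (≤-respʳ-≈ (trans (distribˡ x z (- y)) (+-congˡ (sym (-‿distribʳ-* x y))))
      (*-nonNeg 0≤x (x≤y⇒0≤y-x y≤z)))

  sum-mono-≤ : ∀ {n} {f g : Vector Carrier n} → (∀ i → f i ≤ g i) → sum f ≤ sum g
  sum-mono-≤ {zero}  f≤g = ≤-refl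
  sum-mono-≤ {suc n} f≤g = +-mono-≤ (f≤g zero) (sum-mono-≤ (λ i → f≤g (suc i)))

module Nuel
  (ℝ : RealNumbers) {N : ℕ} (p : Fin N → RealNumbers.Carrier ℝ)
  (p∈⟨0,1⟩ : ∀ n → RealNumbers._<_ ℝ (RealNumbers.0# ℝ) (p n) ×
                   RealNumbers._<_ ℝ (p n) (RealNumbers.1# ℝ))
  where

  open RealNumbers ℝ
  open OrderLemmas ℝ

  -- `over A` is the state 0 s₁ … s_N and `move m A` is the state m s₁ … s_N,
  -- where A = { j : s_j = 1 } is the set of players alive.
  data State : Set where
    over : Subset N → State
    move : Fin N → Subset N → State

  data Admissible : State → Set where
    terminal : ∀ {A} → ∣ A ∣ ≡ 1 → Admissible (over A)
    playing  : ∀ {m A} → m ∈ A → 2 ℕ.≤ ∣ A ∣ → Admissible (move m A)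

  cyclicSuc : Fin N → Fin N
  cyclicSuc i = (suc (toℕ i) mod N) {{nonZeroIndex i}}

  firstAlive : ℕ → Fin N → Subset N → Fin N
  firstAlive zero    i A = i
  firstAlive (suc k) i A =
    if lookup A (cyclicSuc i) then cyclicSuc i else firstAlive k (cyclicSuc i) A

  -- N steps reach every player, the last one being m himself.
  nextAlive : Fin N → Subset N → Fin N
  nextAlive m A = firstAlive N m A

  Target : Fin N → Subset N → Fin N → Set
  Target m A j = j ∈ A × j ≢ m

  target? : ∀ m A j → Dec (Target m A j)
  target? m A j = (j ∈? A) ×-dec ¬? (j ≟ m)

  afterKill : Fin N → Subset N → State
  afterKill m B = if ∣ B ∣ ≡ᵇ 1 then over B else move (nextAlive m B) B

  -- s —[ j ]→ s′ : the mover at s shoots at P_j and the new state is s′.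
  -- Both outcomes have positive probability since 0 < p < 1.
  data _—[_]→_ : State → Fin N → State → Set where
    hit  : ∀ {m A j} → Target m A j → move m A —[ j ]→ afterKill m (A ∖ j)
    miss : ∀ {m A j} → Target m A j → move m A —[ j ]→ move (nextAlive m A) A

  -- Histories s(0) a(1) s(1) … a(t) s(t), indexed by the current state s(t);
  -- the nonterminal ones are those of type History (move m A).
  infixl 5 _▻_
  data History : State → Set where
    start : ∀ {s} → Admissible s → History s
    _▻_   : ∀ {s j s′} → History s → s —[ j ]→ s′ → History s′

  record Strategy (n : Fin N) : Set where
    field
      prob    : ∀ {m A} → History (move m A) → Vector Carrier N
      idle    : ∀ {m A} (h : History (move m A)) → m ≢ n → ∀ j → prob h j ≈ 0#
      nonNeg  : ∀ {A} (h : History (move n A)) j → 0# ≤ prob h j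
      sum≈1   : ∀ {A} (h : History (move n A)) → sum (prob h) ≈ 1#
      support : ∀ {A} (h : History (move n A)) j → ¬ Target n A j → prob h j ≈ 0#

  open Strategy public

  Profile : Set
  Profile = ∀ n → Strategy n

  infixl 6 _[_≔_]
  _[_≔_] : Profile → ∀ n → Strategy n → Profile
  (σ [ n ≔ τ ]) m with n ≟ m
  ... | yes ≡.refl = τ
  ... | no  _      = σ m

  Stationary : Profile → Set
  Stationary σ = ∀ n {m A} (h h′ : History (move m A)) j →
                 prob (σ n) h j ≈ prob (σ n) h′ j

  Deterministic : Profile → Set
  Deterministic σ = ∀ n {A} (h : History (move n A)) → ∃[ j ] prob (σ n) h j ≈ 1#

  -- winWithin σ n t h is the probability that, continuing from h under σ, the
  -- game ends after at most t further shots with P_n as the survivor.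
  winWithin : Profile → Fin N → ℕ → ∀ {s} → History s → Carrier
  shotTerm  : Profile → Fin N → ℕ → ∀ {m A} → History (move m A) →
              ∀ j → Dec (Target m A j) → Carrier

  winWithin σ n t       {over A}   h = if lookup A n then 1# else 0#
  winWithin σ n zero    {move m A} h = 0#
  winWithin σ n (suc t) {move m A} h = sum λ j → shotTerm σ n t h j (target? m A j)

  shotTerm σ n t {m} h j (yes ok) =
    prob (σ m) h j * (p m * winWithin σ n t (h ▻ hit ok)
                      + (1# - p m) * winWithin σ n t (h ▻ miss ok))
  shotTerm σ n t     h j (no _)   = 0#

  0≤p : ∀ n → 0# ≤ p n
  0≤p n = proj₁ (proj₁ (p∈⟨0,1⟩ n))

  p≤1 : ∀ n → p n ≤ 1#
  p≤1 n = proj₁ (proj₂ (p∈⟨0,1⟩ n))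

  winWithin≤1 : ∀ σ n t {s} (h : History s) → winWithin σ n t h ≤ 1#
  shotTerm≤prob : ∀ σ n t {m A} (h : History (move m A)) j (d : Dec (Target m A j)) →
                  shotTerm σ n t h j d ≤ prob (σ m) h j

  winWithin≤1 σ n t {over A} h with lookup A n
  ... | true  = ≤-refl
  ... | false = ≤-trans (0≤p n) (p≤1 n)
  winWithin≤1 σ n zero    {move m A} h = ≤-trans (0≤p n) (p≤1 n)
  winWithin≤1 σ n (suc t) {move m A} h =
    ≤-respʳ-≈ (sum≈1 (σ m) h)
      (sum-mono-≤ (λ j → shotTerm≤prob σ n t h j (target? m A j)))

  shotTerm≤prob σ n t {m} h j (yes ok) =
    ≤-respʳ-≈ (*-identityʳ _) (*-monoʳ-≤ (nonNeg (σ m) h j)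
      (≤-respʳ-≈ (trans (+-cong (*-identityʳ _) (*-identityʳ _)) (y+[x-y]≈x 1# (p m)))
        (+-mono-≤
          (*-monoʳ-≤ (0≤p m) (winWithin≤1 σ n t (h ▻ hit ok)))
          (*-monoʳ-≤ (x≤y⇒0≤y-x (p≤1 m)) (winWithin≤1 σ n t (h ▻ miss ok))))))
  shotTerm≤prob σ n t {m} h j (no _) = nonNeg (σ m) h j

  WinProbabilities : Profile → Fin N → ∀ {s} → Admissible s → Pred Carrier 0ℓ
  WinProbabilities σ n adm x = ∃[ t ] x ≈ winWithin σ n t (start adm)

  -- The event that P_n wins is the increasing union over t of the events that
  -- P_n has won within t shots, so its probability is the supremum (= limit)
  -- of theirs; P_n's expected payoff is this probability, as plays that P_n
  -- does not win, in particular infinite ones, pay him 0.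
  Q-lub : ∀ n {s} (adm : Admissible s) σ →
          ∃ (LeastUpperBound (WinProbabilities σ n adm))
  Q-lub n adm σ = complete (WinProbabilities σ n adm)
    (winWithin σ n 0 (start adm) , 0 , refl)
    (1# , λ (t , x≈w) → ≤-respˡ-≈ (sym x≈w) (winWithin≤1 σ n t (start adm)))

  Q : Fin N → ∀ {s} → Admissible s → Profile → Carrier
  Q n adm σ = proj₁ (Q-lub n adm σ)

  NashEquilibrium : Profile → Set
  NashEquilibrium σ̂ = ∀ {s} (adm : Admissible s) n (τ : Strategy n) →
                      Q n adm (σ̂ [ n ≔ τ ]) ≤ Q n adm σ̂

{-# OPTIONS --safe #-}

-- The miss probability 1 - p_m does not depend on whom P_m aims at, so what
-- P_m gains by aiming at P_j is governed solely by his value in the subgame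
-- without P_j.  By induction on the number of players alive, let every player
-- aim at a victim maximising that value.  The resulting value function V_n is
-- then superharmonic along every profile in which only P_n deviates, so by
-- induction on t it bounds P_n's probability of winning within t shots there.

module Submission where

open import Defs
open import Data.Bool.Base using (true; false; if_then_else_; T)
open import Data.Fin.Base using (Fin; zero; suc)
open import Data.Fin.Properties using (_≟_; any?; suc-injective)
open import Data.Fin.Subset using (Subset; _∈_; ∣_∣; ⁅_⁆) renaming (_-_ to _∖_)
open import Data.Fin.Subset.Properties
  using (_∈?_; p⊆q⇒∣p∣≤∣q∣; ∣p∣≤n; ∣⁅x⁆∣≡1; ∣p─q∣≤∣p∣; x∈⁅x⁆; x∈⁅y⁆⇒x≡y;
         x∈p∧x≢y⇒x∈p-y; x∈p⇒∣p-x∣<∣p∣)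
import Data.List.Extrema as Extrema
open import Data.List.Base using (filter; allFin)
open import Data.List.Membership.Propositional.Properties using (∈-allFin; ∈-filter⁺)
import Data.List.Relation.Unary.All as All
open import Data.List.Relation.Unary.All.Properties using (all-filter)
open import Data.Nat.Base as ℕ using (ℕ; zero; suc)
import Data.Nat.Properties as ℕₚ
open import Data.Product.Base using (_×_; _,_; proj₁; proj₂; ∃; ∃-syntax)
open import Data.Sum.Base using (_⊎_; inj₁; inj₂)
open import Data.Vec.Base using (lookup)
open import Data.Vec.Functional using (Vector)
open import Function.Base using (_∘_)
open import Level using (0ℓ)
import Algebra.Properties.CommutativeMonoid.Sum as CommutativeMonoidSum
import Algebra.Properties.Ring as RingProperties
import Algebra.Properties.Semiring.Sum as SemiringSum
open import Relation.Binary.Bundles using (Poset; TotalOrder)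
open import Relation.Binary.PropositionalEquality.Core as ≡ using (_≡_; _≢_)
import Relation.Binary.Reasoning.PartialOrder as PartialOrderReasoning
open import Relation.Binary.Structures using (IsTotalOrder)
open import Relation.Nullary using (¬_; Dec; yes; no; does; contradiction)
open import Relation.Nullary.Decidable using (¬?; _×-dec_; decidable-stable)
open import Relation.Unary using (Pred; Decidable)

-- Counting the players left alive.

module _ {N : ℕ} where

  another : ∀ (m : Fin N) {A} → 2 ℕ.≤ ∣ A ∣ → ∃[ j ] (j ∈ A × j ≢ m)
  another m {A} 2≤∣A∣ with any? (λ j → (j ∈? A) ×-dec ¬? (j ≟ m))
  ... | yes found = found
  ... | no  none  = contradiction 2≤∣A∣ (ℕₚ.≤⇒≯ ∣A∣≤1)
    where
    A⊆⁅m⁆ : ∀ {j} → j ∈ A → j ∈ ⁅ m ⁆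
    A⊆⁅m⁆ {j} j∈A = ≡.subst (_∈ ⁅ m ⁆)
      (≡.sym (decidable-stable (j ≟ m) λ j≢m → none (j , j∈A , j≢m))) (x∈⁅x⁆ m)

    ∣A∣≤1 : ∣ A ∣ ℕ.≤ 1
    ∣A∣≤1 = ≡.subst (∣ A ∣ ℕ.≤_) (∣⁅x⁆∣≡1 m) (p⊆q⇒∣p∣≤∣q∣ A⊆⁅m⁆)

  1≤∣p-x∣ : ∀ p (x : Fin N) → 2 ℕ.≤ ∣ p ∣ → 1 ℕ.≤ ∣ p ∖ x ∣
  1≤∣p-x∣ p x 2≤∣p∣ with another x 2≤∣p∣
  ... | y , y∈p , y≢x = ≡.subst (ℕ._≤ ∣ p ∖ x ∣) (∣⁅x⁆∣≡1 y)
    (p⊆q⇒∣p∣≤∣q∣ λ z∈⁅y⁆ → ≡.subst (_∈ p ∖ x) (≡.sym (x∈⁅y⁆⇒x≡y y z∈⁅y⁆))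
                              (x∈p∧x≢y⇒x∈p-y y∈p y≢x))

-- Ordered fields: finite sums, maxima, suprema and convex combinations.

module OrderedField (ℝ : RealNumbers) where
  open RealNumbers ℝ
  open OrderLemmas ℝ public
  open RingProperties ring using (-1*x≈-x; -‿involutive)
  open CommutativeMonoidSum +-commutativeMonoid using (sum-cong-≋; sum-replicate-zero)

  poset : Poset 0ℓ 0ℓ 0ℓ
  poset = record { isPartialOrder = IsTotalOrder.isPartialOrder isTotalOrder }

  totalOrder : TotalOrder 0ℓ 0ℓ 0ℓ
  totalOrder = record { isTotalOrder = isTotalOrder }

  module ≤-Reasoning = PartialOrderReasoning poset
  open ≤-Reasoning

  sum-concentrated : ∀ {n} {f : Vector Carrier n} i →
                     (∀ j → j ≢ i → f j ≈ 0#) → sum f ≈ f i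
  sum-concentrated {suc n} {f} zero f≈0 = begin-equality
    f zero + sum (f ∘ suc)       ≈⟨ +-congˡ (sum-cong-≋ λ j → f≈0 (suc j) λ ()) ⟩
    f zero + sum {n} (λ _ → 0#)  ≈⟨ +-congˡ (sum-replicate-zero n) ⟩
    f zero + 0#                  ≈⟨ +-identityʳ _ ⟩
    f zero                       ∎
  sum-concentrated {suc n} {f} (suc i) f≈0 = begin-equality
    f zero + sum (f ∘ suc)  ≈⟨ +-cong (f≈0 zero λ ())
                                 (sum-concentrated i λ j j≢i → f≈0 (suc j) (j≢i ∘ suc-injective)) ⟩
    0# + f (suc i)          ≈⟨ +-identityˡ _ ⟩
    f (suc i)               ∎

  indicator : ∀ {P : Set} → Dec P → Carrier
  indicator P? = if does P? then 1# else 0#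

  indicator-yes : ∀ {P : Set} (P? : Dec P) → P → indicator P? ≈ 1#
  indicator-yes (yes _) _ = refl
  indicator-yes (no ¬p) p = contradiction p ¬p

  indicator-no : ∀ {P : Set} (P? : Dec P) → ¬ P → indicator P? ≈ 0#
  indicator-no (yes p) ¬p = contradiction p ¬p
  indicator-no (no _)  _  = refl

  -- `argmax` returns its default or a member of the list, so the witness `j₀` as default keeps the
  -- result inside `P`.
  maximiser : ∀ {n} {P : Pred (Fin n) 0ℓ} → Decidable P → (f : Fin n → Carrier) →
              ∃ P → ∃[ j ] (P j × ∀ i → P i → f i ≤ f j)
  maximiser {n} {P} P? f (j₀ , Pj₀) =
    argmax f j₀ candidates ,
    argmax-all f Pj₀ (all-filter P? (allFin n)) ,
    λ i Pi → All.lookup (f[xs]≤f[argmax] j₀ candidates) (∈-filter⁺ P? (∈-allFin i) Pi)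
    where
    open Extrema totalOrder using (argmax; argmax-all; f[xs]≤f[argmax])
    candidates = filter P? (allFin n)

  +≤⇒≤- : ∀ {x y z} → x + y ≤ z → x ≤ z - y
  +≤⇒≤- {x} {y} {z} x+y≤z = begin
    x              ≈⟨ +-identityʳ x ⟨
    x + 0#         ≈⟨ +-congˡ (-‿inverseʳ y) ⟨
    x + (y - y)    ≈⟨ +-assoc x y (- y) ⟨
    x + y - y      ≤⟨ +-mono-≤ x+y≤z ≤-refl ⟩
    z - y          ∎

  ≤-⇒+≤ : ∀ {x y z} → x ≤ z - y → y + x ≤ z
  ≤-⇒+≤ {x} {y} {z} x≤z-y = ≤-respʳ-≈ (y+[x-y]≈x z y) (+-monoʳ-≤ y x≤z-y)

  0≤1 : 0# ≤ 1#
  0≤1 with total 0# 1#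
  ... | inj₁ 0≤1 = 0≤1
  ... | inj₂ 1≤0 = begin
    0#           ≤⟨ *-nonNeg 0≤-1 0≤-1 ⟩
    - 1# * - 1#  ≈⟨ -1*x≈-x (- 1#) ⟩
    - - 1#       ≈⟨ -‿involutive 1# ⟩
    1#           ∎
    where
    0≤-1 : 0# ≤ - 1#
    0≤-1 = ≤-respʳ-≈ (+-identityˡ (- 1#)) (x≤y⇒0≤y-x 1≤0)

  0≤indicator : ∀ {P : Set} (P? : Dec P) → 0# ≤ indicator P?
  0≤indicator (yes _) = 0≤1
  0≤indicator (no _)  = ≤-refl

  inverse-nonNeg : ∀ {x y} → 0# ≤ x → x * y ≈ 1# → 0# ≤ y
  inverse-nonNeg {x} {y} 0≤x xy≈1 with total 0# y
  ... | inj₁ 0≤y = 0≤y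
  ... | inj₂ y≤0 = contradiction (antisym 0≤1 1≤0) 0≉1
    where
    1≤0 : 1# ≤ 0#
    1≤0 = begin
      1#      ≈⟨ xy≈1 ⟨
      x * y   ≤⟨ *-monoʳ-≤ 0≤x y≤0 ⟩
      x * 0#  ≈⟨ zeroʳ x ⟩
      0#      ∎

  -- Dividing by `c` makes `c⁻¹ * d` an upper bound of `A`, hence of `s`; positivity of `c` gives
  -- both the inverse and its sign.
  *-lub-≤ : ∀ {c d s A} → 0# < c → LeastUpperBound A s →
            (∀ {x} → A x → c * x ≤ d) → c * s ≤ d
  *-lub-≤ {c} {d} {s} {A} (0≤c , 0≉c) (_ , least) cx≤d
    with c⁻¹ , cc⁻¹≈1 ← invertible (0≉c ∘ sym) = begin
      c * s          ≤⟨ *-monoʳ-≤ 0≤c (least x≤c⁻¹d) ⟩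
      c * (c⁻¹ * d)  ≈⟨ *-assoc c c⁻¹ d ⟨
      c * c⁻¹ * d    ≈⟨ *-congʳ cc⁻¹≈1 ⟩
      1# * d         ≈⟨ *-identityˡ d ⟩
      d              ∎
    where
    x≤c⁻¹d : UpperBound A (c⁻¹ * d)
    x≤c⁻¹d {x} Ax = begin
      x              ≈⟨ *-identityˡ x ⟨
      1# * x         ≈⟨ *-congʳ (trans (*-comm c⁻¹ c) cc⁻¹≈1) ⟨
      c⁻¹ * c * x    ≈⟨ *-assoc c⁻¹ c x ⟩
      c⁻¹ * (c * x)  ≤⟨ *-monoʳ-≤ (inverse-nonNeg 0≤c cc⁻¹≈1) (cx≤d Ax) ⟩
      c⁻¹ * d        ∎

  mix : Carrier → Carrier → Carrier → Carrier
  mix a x y = a * x + (1# - a) * y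

  mix-idem : ∀ a x → mix a x x ≈ x
  mix-idem a x = begin-equality
    a * x + (1# - a) * x  ≈⟨ distribʳ x a (1# - a) ⟨
    (a + (1# - a)) * x    ≈⟨ *-congʳ (y+[x-y]≈x 1# a) ⟩
    1# * x                ≈⟨ *-identityˡ x ⟩
    x                     ∎

  module Mix {a} (0<a : 0# < a) (a<1 : a < 1#) where

    0≤1-a : 0# ≤ 1# - a
    0≤1-a = x≤y⇒0≤y-x (proj₁ a<1)

    0<1-a : 0# < 1# - a
    0<1-a = 0≤1-a , λ 0≈1-a → proj₂ a<1 (begin-equality
      a               ≈⟨ +-identityʳ a ⟨
      a + 0#          ≈⟨ +-congˡ 0≈1-a ⟩
      a + (1# - a)    ≈⟨ y+[x-y]≈x 1# a ⟩
      1#              ∎)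

    mix-mono-≤ : ∀ {x x′ y y′} → x ≤ x′ → y ≤ y′ → mix a x y ≤ mix a x′ y′
    mix-mono-≤ x≤x′ y≤y′ = +-mono-≤ (*-monoʳ-≤ (proj₁ 0<a) x≤x′) (*-monoʳ-≤ 0≤1-a y≤y′)

    0≤mix : ∀ {x y} → 0# ≤ x → 0# ≤ y → 0# ≤ mix a x y
    0≤mix 0≤x 0≤y = ≤-respˡ-≈ (mix-idem a 0#) (mix-mono-≤ 0≤x 0≤y)

    -- The two suprema are approached independently. Both weights are positive, so `*-lub-≤` applies
    -- to one term with the other moved to the right: first to `x` with `y` fixed, then to `y` with
    -- `r` already in place.
    mix-lub-≤ : ∀ {r s d A B} → LeastUpperBound A r → LeastUpperBound B s →
                (∀ {x y} → A x → B y → mix a x y ≤ d) → mix a r s ≤ d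
    mix-lub-≤ lubA lubB mix≤d = ≤-⇒+≤ (*-lub-≤ 0<1-a lubB λ By →
      +≤⇒≤- (≤-⇒+≤ (*-lub-≤ 0<a lubA λ Ax → +≤⇒≤- (mix≤d Ax By))))

module Greedy
  (ℝ : RealNumbers) {N : ℕ} (p : Fin N → RealNumbers.Carrier ℝ)
  (p∈⟨0,1⟩ : ∀ n → RealNumbers._<_ ℝ (RealNumbers.0# ℝ) (p n) ×
                   RealNumbers._<_ ℝ (p n) (RealNumbers.1# ℝ))
  where

  open RealNumbers ℝ
  open OrderedField ℝ
  open SemiringSum semiring using (*-distribʳ-sum)
  open Nuel ℝ p p∈⟨0,1⟩
  open ≤-Reasoning hiding (start)

  private
    module MixAt (m : Fin N) = Mix (proj₁ (p∈⟨0,1⟩ m)) (proj₂ (p∈⟨0,1⟩ m))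
  open MixAt using (mix-mono-≤; 0≤mix; mix-lub-≤)

  -- Values of pure stationary rules.

  Rule : Set
  Rule = Fin N → Subset N → Fin N

  ifHit : Fin N → Subset N → Fin N → State
  ifHit m A j = afterKill m (A ∖ j)

  ifMissed : Fin N → Subset N → State
  ifMissed m A = move (nextAlive m A) A

  -- Recursion on states instead of histories is enough because a rule ignores the past;
  -- `winWithin≈winBy` links it to the game when `f` is valid.
  winBy : Rule → Fin N → ℕ → State → Carrier
  winBy f n t       (over A)   = if lookup A n then 1# else 0#
  winBy f n zero    (move m A) = 0#
  winBy f n (suc t) (move m A) =
    mix (p m) (winBy f n t (ifHit m A (f m A))) (winBy f n t (ifMissed m A))

  module _ (f : Rule) (n : Fin N) where

    0≤winBy : ∀ t s → 0# ≤ winBy f n t s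
    0≤winBy t       (over A) with lookup A n
    ... | true  = 0≤1
    ... | false = ≤-refl
    0≤winBy zero    (move m A) = ≤-refl
    0≤winBy (suc t) (move m A) =
      0≤mix m (0≤winBy t (ifHit m A (f m A))) (0≤winBy t (ifMissed m A))

    winBy≤1 : ∀ t s → winBy f n t s ≤ 1#
    winBy≤1 t       (over A) with lookup A n
    ... | true  = ≤-refl
    ... | false = 0≤1
    winBy≤1 zero    (move m A) = 0≤1
    winBy≤1 (suc t) (move m A) = ≤-respʳ-≈ (mix-idem (p m) 1#)
      (mix-mono-≤ m (winBy≤1 t (ifHit m A (f m A))) (winBy≤1 t (ifMissed m A)))

    winBy-mono : ∀ {t u} → t ℕ.≤ u → ∀ s → winBy f n t s ≤ winBy f n u s
    winBy-mono t≤u               (over A)   = ≤-refl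
    winBy-mono {u = u} ℕ.z≤n     (move m A) = 0≤winBy u (move m A)
    winBy-mono         (ℕ.s≤s t≤u) (move m A) =
      mix-mono-≤ m (winBy-mono t≤u (ifHit m A (f m A))) (winBy-mono t≤u (ifMissed m A))

    WinProbabilitiesBy : State → Pred Carrier 0ℓ
    WinProbabilitiesBy s x = ∃[ t ] x ≈ winBy f n t s

    value-lub : ∀ s → ∃ (LeastUpperBound (WinProbabilitiesBy s))
    value-lub s = complete (WinProbabilitiesBy s) (winBy f n 0 s , 0 , refl)
      (1# , λ (t , x≈w) → ≤-respˡ-≈ (sym x≈w) (winBy≤1 t s))

    value : State → Carrier
    value s = proj₁ (value-lub s)

    winBy≤value : ∀ t s → winBy f n t s ≤ value s
    winBy≤value t s = proj₁ (proj₂ (value-lub s)) (t , refl)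

    value-least : ∀ {s b} → (∀ t → winBy f n t s ≤ b) → value s ≤ b
    value-least {s} w≤b =
      proj₂ (proj₂ (value-lub s)) λ (t , x≈w) → ≤-respˡ-≈ (sym x≈w) (w≤b t)

    0≤value : ∀ s → 0# ≤ value s
    0≤value s = ≤-trans (0≤winBy 0 s) (winBy≤value 0 s)

    -- The half of the Bellman equation that bounds deviations. The two suprema may be approached at
    -- different horizons `t` and `u`; monotonicity lifts both to their maximum, and the shot at
    -- hand adds one.
    value-superharmonic : ∀ m A →
      mix (p m) (value (ifHit m A (f m A))) (value (ifMissed m A)) ≤ value (move m A)
    value-superharmonic m A =
      mix-lub-≤ m (proj₂ (value-lub hit-state)) (proj₂ (value-lub miss-state))
        λ {x} {y} (t , x≈) (u , y≈) → begin
          mix (p m) x y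
            ≤⟨ mix-mono-≤ m
                 (≤-respˡ-≈ (sym x≈) (winBy-mono (ℕₚ.m≤m⊔n t u) hit-state))
                 (≤-respˡ-≈ (sym y≈) (winBy-mono (ℕₚ.m≤n⊔m t u) miss-state)) ⟩
          winBy f n (suc (t ℕ.⊔ u)) (move m A)
            ≤⟨ winBy≤value (suc (t ℕ.⊔ u)) (move m A) ⟩
          value (move m A) ∎
      where
      hit-state miss-state : State
      hit-state  = ifHit m A (f m A)
      miss-state = ifMissed m A

  -- Locality: values depend on the rule only at sets of survivors.

  alive : State → Subset N
  alive (over A)   = A
  alive (move _ A) = A

  alive-afterKill : ∀ m B → alive (afterKill m B) ≡ B
  alive-afterKill m B with ∣ B ∣ ℕ.≡ᵇ 1
  ... | true  = ≡.refl
  ... | false = ≡.refl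

  ∣alive-ifHit∣≤ : ∀ {k} m A j → ∣ A ∖ j ∣ ℕ.≤ k → ∣ alive (ifHit m A j) ∣ ℕ.≤ k
  ∣alive-ifHit∣≤ {k} m A j =
    ≡.subst (λ B → ∣ B ∣ ℕ.≤ k) (≡.sym (alive-afterKill m (A ∖ j)))

  AgreeUpTo : ℕ → Rule → Rule → Set
  AgreeUpTo k f g = ∀ m A → ∣ A ∣ ℕ.≤ k → f m A ≡ g m A

  -- The number of players alive never grows during play, so from `s` the rule is consulted only at
  -- sets of size at most `k`.
  winBy-local : ∀ {k f g} → AgreeUpTo k f g →
                ∀ n t s → ∣ alive s ∣ ℕ.≤ k → winBy f n t s ≡ winBy g n t s
  winBy-local f≗g n t       (over A)   _ = ≡.refl
  winBy-local f≗g n zero    (move m A) _ = ≡.refl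
  winBy-local {k} {f} {g} f≗g n (suc t) (move m A) ∣A∣≤k rewrite f≗g m A ∣A∣≤k =
    ≡.cong₂ (mix (p m))
      (winBy-local {k} {f} {g} f≗g n t (ifHit m A (g m A))
        (∣alive-ifHit∣≤ m A (g m A) (ℕₚ.≤-trans (∣p─q∣≤∣p∣ A ⁅ g m A ⁆) ∣A∣≤k)))
      (winBy-local {k} {f} {g} f≗g n t (ifMissed m A) ∣A∣≤k)

  -- An inequality suffices, as exchanging `f` and `g` gives the opposite one.
  value-local : ∀ {k f g} → AgreeUpTo k f g →
                ∀ n s → ∣ alive s ∣ ℕ.≤ k → value f n s ≤ value g n s
  value-local {k} {f} {g} f≗g n s ∣s∣≤k = value-least f n {s} λ t →
    ≡.subst (_≤ value g n s) (≡.sym (winBy-local {k} {f} {g} f≗g n t s ∣s∣≤k))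
      (winBy≤value g n t s)

  -- Construction of a greedy rule.

  Valid : Rule → Set
  Valid f = ∀ m A → 2 ℕ.≤ ∣ A ∣ → Target m A (f m A)

  -- Only values after a kill are compared: a miss leads to the same state with the same weight
  -- whatever the target.
  GreedyAt : Rule → Fin N → Subset N → Fin N → Set
  GreedyAt f m A j =
    ∀ i → Target m A i → value f m (ifHit m A i) ≤ value f m (ifHit m A j)

  GreedyUpTo : ℕ → Rule → Set
  GreedyUpTo k f = ∀ m A → 2 ℕ.≤ ∣ A ∣ → ∣ A ∣ ℕ.≤ k → GreedyAt f m A (f m A)

  validRule : ∃ Valid
  validRule = (λ m A → proj₁ (choice m A)) , (λ m A → proj₂ (choice m A))
    where
    choice : ∀ m A → ∃[ j ] (2 ℕ.≤ ∣ A ∣ → Target m A j)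
    choice m A with 2 ℕₚ.≤? ∣ A ∣
    ... | yes 2≤∣A∣ = proj₁ (another m 2≤∣A∣) , λ _ → proj₂ (another m 2≤∣A∣)
    -- Such sets put no demand on the rule, so `m` is a mere filler.
    ... | no  2≰∣A∣ = m , λ 2≤∣A∣ → contradiction 2≤∣A∣ 2≰∣A∣

  -- A kill from at most `suc k` players leaves at most `k`, where `g` copies `f`. Targets that
  -- maximise `value f` therefore maximise `value g`, which removes the circularity of being greedy
  -- for one's own value.
  extend : ∀ {k f} → Valid f → GreedyUpTo k f → ∃[ g ] (Valid g × GreedyUpTo (suc k) g)
  extend {k} {f} f-valid f-greedy = g , g-valid , g-greedy
    where
    Choice : Fin N → Subset N → Fin N → Set
    Choice m A j =
      (2 ℕ.≤ ∣ A ∣ → Target m A j × GreedyAt f m A j) × (∣ A ∣ ℕ.≤ k → f m A ≡ j)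

    choose : ∀ m A → Dec (∣ A ∣ ℕ.≤ k) → Dec (2 ℕ.≤ ∣ A ∣) → ∃ (Choice m A)
    -- Earlier choices are kept, not recomputed: ties might be broken differently, and `g` would no
    -- longer agree with `f`.
    choose m A (yes ∣A∣≤k) _ =
      f m A , (λ 2≤∣A∣ → f-valid m A 2≤∣A∣ , f-greedy m A 2≤∣A∣ ∣A∣≤k) , λ _ → ≡.refl
    choose m A (no ∣A∣≰k) (no 2≰∣A∣) =
      m , (λ 2≤∣A∣ → contradiction 2≤∣A∣ 2≰∣A∣) , λ ∣A∣≤k → contradiction ∣A∣≤k ∣A∣≰k
    choose m A (no ∣A∣≰k) (yes 2≤∣A∣) =
      proj₁ best , (λ _ → proj₂ best) , λ ∣A∣≤k → contradiction ∣A∣≤k ∣A∣≰k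
      where
      best : ∃[ j ] (Target m A j × GreedyAt f m A j)
      best = maximiser (target? m A) (λ i → value f m (ifHit m A i)) (another m 2≤∣A∣)

    choice : ∀ m A → ∃ (Choice m A)
    choice m A = choose m A (∣ A ∣ ℕₚ.≤? k) (2 ℕₚ.≤? ∣ A ∣)

    g : Rule
    g m A = proj₁ (choice m A)

    g-valid : Valid g
    g-valid m A 2≤∣A∣ = proj₁ (proj₁ (proj₂ (choice m A)) 2≤∣A∣)

    f≗g : AgreeUpTo k f g
    f≗g m A = proj₂ (proj₂ (choice m A))

    g-greedy : GreedyUpTo (suc k) g
    g-greedy m A 2≤∣A∣ ∣A∣≤1+k i i-target = begin
      value g m (ifHit m A i)
        ≤⟨ value-local {k} {g} {f} (λ m A ∣A∣≤k → ≡.sym (f≗g m A ∣A∣≤k))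
             m (ifHit m A i) (fewer i i-target) ⟩
      value f m (ifHit m A i)
        ≤⟨ proj₂ (proj₁ (proj₂ (choice m A)) 2≤∣A∣) i i-target ⟩
      value f m (ifHit m A (g m A))
        ≤⟨ value-local {k} {f} {g} f≗g
             m (ifHit m A (g m A)) (fewer (g m A) (g-valid m A 2≤∣A∣)) ⟩
      value g m (ifHit m A (g m A)) ∎
      where
      fewer : ∀ j → Target m A j → ∣ alive (ifHit m A j) ∣ ℕ.≤ k
      fewer j (j∈A , _) =
        ∣alive-ifHit∣≤ m A j (ℕ.s≤s⁻¹ (ℕₚ.≤-trans (x∈p⇒∣p-x∣<∣p∣ j∈A) ∣A∣≤1+k))

  greedyRule : ∀ k → ∃[ f ] (Valid f × GreedyUpTo k f)
  greedyRule zero =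
    proj₁ validRule , proj₂ validRule ,
    -- Greediness up to size 0 is vacuous, so any valid rule starts the induction.
    λ m A 2≤∣A∣ ∣A∣≤0 → contradiction (ℕₚ.≤-trans 2≤∣A∣ ∣A∣≤0) λ ()
  greedyRule (suc k) with _ , f-valid , f-greedy ← greedyRule k =
    extend f-valid f-greedy

  -- Sizes of reachable states.

  afterKill-move : ∀ {m} B {m′ A} → afterKill m B ≡ move m′ A → 1 ℕ.≤ ∣ B ∣ → 2 ℕ.≤ ∣ A ∣
  -- The test excludes size 1 only; `afterKill` sends the empty set to a `move` state too, and
  -- `1≤∣B∣` rules that out.
  afterKill-move B eq 1≤∣B∣ with ∣ B ∣ ℕ.≡ᵇ 1 in ∣B∣≡ᵇ1
  afterKill-move B ≡.refl 1≤∣B∣ | false =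
    ℕₚ.≤∧≢⇒< 1≤∣B∣ λ 1≡∣B∣ → ≡.subst T ∣B∣≡ᵇ1 (ℕₚ.≡⇒≡ᵇ ∣ B ∣ 1 (≡.sym 1≡∣B∣))

  -- Supplies the size hypothesis of `Valid` wherever someone has to shoot. The state is tied to
  -- `move m A` by an equation because unification cannot invert `afterKill` in the `hit` case.
  History⇒2≤∣A∣ : ∀ {s} → History s → ∀ {m A} → s ≡ move m A → 2 ℕ.≤ ∣ A ∣
  History⇒2≤∣A∣ (start (playing _ 2≤∣A∣)) ≡.refl = 2≤∣A∣
  History⇒2≤∣A∣ (h ▻ hit {A = A} {j} _)   eq     =
    afterKill-move (A ∖ j) eq (1≤∣p-x∣ A j (History⇒2≤∣A∣ h ≡.refl))
  History⇒2≤∣A∣ (h ▻ miss _)              ≡.refl = History⇒2≤∣A∣ h ≡.refl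

  -- The profile induced by a rule, and deviations from it.

  module Play {f : Rule} (f-valid : Valid f) where

    shoots? : ∀ n m A j → Dec (m ≡ n × j ≡ f m A)
    shoots? n m A j = (m ≟ n) ×-dec (j ≟ f m A)

    strategy : Profile
    strategy n .prob {m} {A} _ j = indicator (shoots? n m A j)
    strategy n .idle {m} {A} _ m≢n j = indicator-no (shoots? n m A j) (m≢n ∘ proj₁)
    strategy n .nonNeg {A} _ j = 0≤indicator (shoots? n n A j)
    strategy n .sum≈1 {A} _ = trans
      (sum-concentrated (f n A) λ j j≢f → indicator-no (shoots? n n A j) (j≢f ∘ proj₂))
      (indicator-yes (shoots? n n A (f n A)) (≡.refl , ≡.refl))
    -- The history guarantees two players alive, so the rule's choice is a target and cannot be `j`.
    strategy n .support {A} h j j-nontarget = indicator-no (shoots? n n A j)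
      λ { (_ , ≡.refl) → j-nontarget (f-valid n A (History⇒2≤∣A∣ h ≡.refl)) }

    stationary : Stationary strategy
    stationary n h h′ j = refl

    deterministic : Deterministic strategy
    deterministic n {A} h =
      f n A , indicator-yes (shoots? n n A (f n A)) (≡.refl , ≡.refl)

    -- All mass sits on `f m A`, so the sum collapses to one shot; validity ensures that `shotTerm`
    -- counts this shot.
    winWithin≈winBy : ∀ n t {s} (h : History s) → winWithin strategy n t h ≈ winBy f n t s
    winWithin≈winBy n t       {over A}   h = refl
    winWithin≈winBy n zero    {move m A} h = refl
    winWithin≈winBy n (suc t) {move m A} h = trans
      (sum-concentrated (f m A) λ j j≢f → missed j≢f (target? m A j))
      (aimed (target? m A (f m A)))
      where
      missed : ∀ {j} → j ≢ f m A → (d : Dec (Target m A j)) →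
               shotTerm strategy n t h j d ≈ 0#
      missed {j} j≢f (yes _) =
        trans (*-congʳ (indicator-no (shoots? m m A j) (j≢f ∘ proj₂))) (zeroˡ _)
      missed     j≢f (no _)  = refl

      aimed : (d : Dec (Target m A (f m A))) →
              shotTerm strategy n t h (f m A) d ≈ winBy f n (suc t) (move m A)
      aimed (yes ok) = trans
        (*-cong (indicator-yes (shoots? m m A (f m A)) (≡.refl , ≡.refl))
                (+-cong (*-congˡ (winWithin≈winBy n t (h ▻ hit ok)))
                        (*-congˡ (winWithin≈winBy n t (h ▻ miss ok)))))
        (*-identityˡ _)
      aimed (no f-nontarget) =
        contradiction (f-valid m A (History⇒2≤∣A∣ h ≡.refl)) f-nontarget

    -- The two alternatives serve two kinds of mover: opponents who follow `f` give other targets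
    -- probability 0, and P_n himself cannot improve on a greedy choice. Quantifying over histories
    -- admits deviations that depend on the past.
    NoBetterThan : Fin N → Profile → Set
    NoBetterThan n σ = ∀ {m A} (h : History (move m A)) j → Target m A j →
      prob (σ m) h j ≈ 0# ⊎ value f n (ifHit m A j) ≤ value f n (ifHit m A (f m A))

    -- Each shot contributes at most its probability times `c`, the one-step value of the rule's own
    -- choice. The probabilities sum to 1, and superharmonicity leads from `c` back to the value.
    winWithin≤value : ∀ {n σ} → NoBetterThan n σ →
                      ∀ t {s} (h : History s) → winWithin σ n t h ≤ value f n s
    winWithin≤value {n} noBetter t    {over A}   h = winBy≤value f n t (over A)
    winWithin≤value {n} noBetter zero {move m A} h = 0≤value f n (move m A)
    winWithin≤value {n} {σ} noBetter (suc t) {move m A} h = begin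
      winWithin σ n (suc t) h        ≤⟨ sum-mono-≤ (λ j → shot≤ j (target? m A j)) ⟩
      sum (λ j → prob (σ m) h j * c) ≈⟨ *-distribʳ-sum c (prob (σ m) h) ⟨
      sum (prob (σ m) h) * c         ≈⟨ *-congʳ (sum≈1 (σ m) h) ⟩
      1# * c                         ≈⟨ *-identityˡ c ⟩
      c                              ≤⟨ value-superharmonic f n m A ⟩
      value f n (move m A)           ∎
      where
      c : Carrier
      c = mix (p m) (value f n (ifHit m A (f m A))) (value f n (ifMissed m A))

      shot≤ : ∀ j (d : Dec (Target m A j)) → shotTerm σ n t h j d ≤ prob (σ m) h j * c
      -- A non-target contributes 0, so the bound only has to be nonnegative.
      shot≤ j (no _) = *-nonNeg (nonNeg (σ m) h j)
        (0≤mix m (0≤value f n (ifHit m A (f m A))) (0≤value f n (ifMissed m A)))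
      shot≤ j (yes ok) with noBetter h j ok
      ... | inj₁ prob≈0 = ≤-reflexive
        (trans (*-congʳ prob≈0) (trans (zeroˡ _) (sym (trans (*-congʳ prob≈0) (zeroˡ c)))))
      ... | inj₂ hit≤   = *-monoʳ-≤ (nonNeg (σ m) h j)
        (mix-mono-≤ m (≤-trans (winWithin≤value noBetter t (h ▻ hit ok)) hit≤)
                      (winWithin≤value noBetter t (h ▻ miss ok)))

    module _ (f-greedy : GreedyUpTo N f) where

      deviation-noBetter : ∀ n (τ : Strategy n) → NoBetterThan n (strategy [ n ≔ τ ])
      -- Deciding `n ≟ m` also reduces `strategy [ n ≔ τ ]` at `m`: to `τ` if P_n moves, otherwise
      -- to the rule. Greediness up to `N` covers every subset, by `∣p∣≤n`.
      deviation-noBetter n τ {m} {A} h j j-target with n ≟ m | j ≟ f m A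
      ... | yes ≡.refl | _ =
        inj₂ (f-greedy n A (History⇒2≤∣A∣ h ≡.refl) (∣p∣≤n A) j j-target)
      ... | no _ | yes ≡.refl = inj₂ ≤-refl
      ... | no _ | no j≢f = inj₁ (indicator-no (shoots? m m A j) (j≢f ∘ proj₂))

      nashEquilibrium : NashEquilibrium strategy
      -- `value f n s` separates the two payoffs: it bounds every horizon of the deviation, and it
      -- is the supremum of the horizons under `strategy`.
      nashEquilibrium {s} adm n τ = ≤-trans deviation≤value value≤Q
        where
        deviation≤value : Q n adm (strategy [ n ≔ τ ]) ≤ value f n s
        deviation≤value = proj₂ (proj₂ (Q-lub n adm (strategy [ n ≔ τ ])))
          λ (t , x≈w) → ≤-respˡ-≈ (sym x≈w)
            (winWithin≤value (deviation-noBetter n τ) t (start adm))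

        value≤Q : value f n s ≤ Q n adm strategy
        value≤Q = value-least f n {s} λ t → proj₁ (proj₂ (Q-lub n adm strategy))
          (t , sym (winWithin≈winBy n t (start adm)))

proposition4p2 : (ℝ : RealNumbers) → let open RealNumbers ℝ in
    ∀ (N : ℕ) → 3 ℕ.≤ N →
    (p : Fin N → Carrier) (p∈⟨0,1⟩ : ∀ n → 0# < p n × p n < 1#) →
    let open Nuel ℝ p p∈⟨0,1⟩ in
    ∃[ σ ] (Stationary σ × Deterministic σ × NashEquilibrium σ)
proposition4p2 ℝ N _ p p∈⟨0,1⟩
  with f , f-valid , f-greedy ← Greedy.greedyRule ℝ p p∈⟨0,1⟩ N =
    strategy , stationary , deterministic , nashEquilibrium f-greedy
  where open Greedy.Play ℝ p p∈⟨0,1⟩ f-valid
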